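{- For every integer $q\equiv 4\pmod 6$ there exists a $q$-ary $3$-frameproof code of length $5$ and cardinality $\frac{5}{3}(q-1)^2+1$.
   Context: For $P\subseteq F^l$ over a finite alphabet $F$, $desc(P)=\{x\in F^l: \text{for every } i\in\{1,\ldots,l\} \text{ there is } y\in P \text{ with } x_i=y_i\}$. For an integer $c\geq 2$, a $c$-frameproof code of length $l$ is a subset $C\subseteq F^l$ with $desc(P)\cap C=P$ for every $P\subseteq C$ with $|P|\leq c$; it is $q$-ary if $|F|=q$. -}

module Defs where

open import Data.Fin.Base using (Fin)
open import Data.List.Base using (List; length)
open import Data.List.Membership.Propositional renaming (_∈_ to _∈ˡ_)
open import Data.List.Relation.Unary.Unique.Propositional using (Unique)
open import Data.Nat.Base using (ℕ; _+_; _*_; _∸_; _^_; _≤_)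
open import Data.Nat.Divisibility using (_∣_; divides; ∣n⇒∣m*n; ∣m⇒∣m*n)
open import Data.Nat.DivMod using (_%_; _/_; m≡m%n+[m/n]*n)
open import Data.Nat.Properties using (*-assoc)
open import Data.Product.Base using (∃-syntax; _×_)
open import Data.Vec.Base using (Vec; lookup)
open import Function.Bundles using (_↔_)
open import Level using (0ℓ)
open import Relation.Binary.PropositionalEquality
  using (_≡_; cong; trans; sym)
open import Relation.Unary using (Pred; _∈_; _⊆_; _≐_; _∩_)

HasSize : {A : Set} → Pred A 0ℓ → ℕ → Set
HasSize {A} P n =
  ∃[ xs ] Unique {A = A} xs × length xs ≡ n × P ≐ (_∈ˡ xs)

SizeAtMost : {A : Set} → Pred A 0ℓ → ℕ → Set
SizeAtMost P c = ∃[ n ] n ≤ c × HasSize P n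

module _ {F : Set} {l : ℕ} where

  desc : Pred (Vec F l) 0ℓ → Pred (Vec F l) 0ℓ
  desc P x = ∀ (i : Fin l) → ∃[ y ] y ∈ P × lookup x i ≡ lookup y i

  Frameproof : ℕ → Pred (Vec F l) 0ℓ → Set₁
  Frameproof c C =
    2 ≤ c × (∀ (P : Pred (Vec F l) 0ℓ) → P ⊆ C → SizeAtMost P c → desc P ∩ C ≐ P)

record FrameproofCode (q c l : ℕ) : Set₁ where
  field
    Alphabet   : Set
    q-ary      : Alphabet ↔ Fin q
    Codeword   : Pred (Vec Alphabet l) 0ℓ
    frameproof : Frameproof c Codeword

-- The division in (5 * (q ∸ 1) ^ 2) / 3 + 1 does not truncate.
3∣5[q∸1]² : ∀ q → q % 6 ≡ 4 → 3 ∣ 5 * (q ∸ 1) ^ 2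
3∣5[q∸1]² q q%6≡4 = ∣n⇒∣m*n 5 (∣m⇒∣m*n ((q ∸ 1) ^ 1) 3∣q∸1)
  where
  k = q / 6

  q∸1≡3+k*6 : q ∸ 1 ≡ 3 + k * 6
  q∸1≡3+k*6 =
    cong (_∸ 1) (trans (m≡m%n+[m/n]*n q 6) (cong (_+ k * 6) q%6≡4))

  3∣q∸1 : 3 ∣ q ∸ 1
  3∣q∸1 = divides (1 + k * 2) (trans q∸1≡3+k*6 (cong (3 +_) (sym (*-assoc k 2 3))))

{-# OPTIONS --safe #-}
-- The nonzero letters are Z₃ × Z_m with q = 3m + 1, m odd.  Besides the zero
-- word, every codeword has exactly one zero, its hole.  A nonzero word is
-- determined by its letters at any two coordinates outside its hole (the blocks
-- form a 4-GDD of type (3m)⁵), and so is the zero word.  Hence outside one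
-- coordinate of a codeword, each other codeword matches it at most once, so three
-- of them cannot cover the four remaining coordinates.
-- The GDD is the one of type 3⁵, namely the translates of {0,1,3,7} in
-- Z₁₅ ≅ Z₅ × Z₃, inflated by the transversal design with lines x, y, x + y,
-- x + 2y over Z_m, where m odd makes every pair of lines independent.
module Submission where

open import Defs
open import Data.Nat.Base using (ℕ; _+_; _*_; _∸_; _^_)
open import Data.Nat.DivMod using (_%_; _/_)
open import Data.Product.Base using (Σ-syntax)
open import Relation.Binary.PropositionalEquality using (_≡_)

open import Data.Fin.Base using (Fin; suc; toℕ; punchIn; combine)
open import Data.Fin.Patterns using (0F; 1F)
import Data.Fin.Properties as Fin
open import Data.Integer.Base as ℤ using (ℤ; +_)
import Data.Integer.Divisibility.Signed as ℤ
import Data.Integer.Properties as ℤ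
import Data.Integer.Tactic.RingSolver as ℤRing
open import Data.List.Base as List
  using (List; []; _∷_; map; length; allFin; cartesianProduct)
import Data.List.Properties as List
open import Data.List.Membership.Propositional renaming (_∈_ to _∈ˡ_)
open import Data.List.Membership.Propositional.Properties using (∈-map⁻)
import Data.List.Relation.Unary.All as All
open import Data.List.Relation.Unary.AllPairs using (_∷_)
open import Data.List.Relation.Unary.Any as Any using (here; there)
open import Data.List.Relation.Unary.Any.Properties using (lookup-index)
import Data.List.Relation.Unary.Unique.Propositional.Properties as Unique
open import Data.Maybe.Base using (Maybe; just; nothing)
import Data.Maybe.Properties as Maybe
open import Data.Nat.Base using (suc; _⊔_; _≤_; _<_; z≤n; s≤s; NonZero; ≢-nonZero)
open import Data.Nat.Coprimality using (Coprime; coprime-divisor)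
open import Data.Nat.Divisibility as ℕ using (_∣_)
open import Data.Nat.DivMod using (_mod_; m%n<n; m≡m%n+[m/n]*n; m*n/n≡m)
import Data.Nat.Properties as ℕ
import Data.Nat.Tactic.RingSolver as ℕRing
open import Data.Product.Base using (∃-syntax; _×_; _,_; proj₁; proj₂)
import Data.Product.Properties as Product
open import Data.Vec.Base as Vec using (Vec; lookup; tabulate; replicate)
open import Data.Vec.Properties using (lookup∘tabulate; lookup-replicate)
open import Function.Base using (id; _∘_)
open import Function.Construct.Identity using (↔-id)
open import Level using (0ℓ)
open import Relation.Binary.PropositionalEquality
  using (_≢_; refl; sym; trans; cong; cong₂; subst; module ≡-Reasoning)
open import Relation.Nullary using (yes; no; contradiction; ¬?; _→-dec_)
open import Relation.Nullary.Decidable using (from-yes)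
open import Relation.Unary using (Pred; _∈_; _⊆_)

-- Frameproofness from rigidity.

module _ {F : Set} {l : ℕ} where

  RigidOff : Fin l → Pred (Vec F l) 0ℓ → Vec F l → Set
  RigidOff i C x =
    ∀ {y} → y ∈ C → ∀ {j k} → j ≢ i → k ≢ i → j ≢ k →
    lookup x j ≡ lookup y j → lookup x k ≡ lookup y k → x ≡ y

-- At most `c` words of `P` cover the `l` coordinates other than `i`, and `c < l`, so by pigeonhole
-- one word covers two of them; rigidity then identifies it with `x`.
rigid⇒frameproof : ∀ {F : Set} {l c} {C : Pred (Vec F (suc l)) 0ℓ} → 2 ≤ c → c < l →
  (∀ {x} → x ∈ C → ∃[ i ] RigidOff i C x) → Frameproof c C
rigid⇒frameproof {F} {l} {c} {C} 2≤c c<l rigid = 2≤c , λ P P⊆C size →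
  covered P P⊆C size , λ x∈P → (λ i → _ , x∈P , refl) , P⊆C x∈P
  where
  covered : ∀ P → P ⊆ C → SizeAtMost P c → ∀ {x} → x ∈ desc P × x ∈ C → x ∈ P
  covered P P⊆C (n , n≤c , xs , _ , refl , P⊆xs , xs⊆P) {x} (x∈desc , x∈C)
    with i , rigidᵢ ← rigid x∈C
    -- The pigeonholes are the positions in `xs` of the covering words.
    with j , k , j<k , same ← Fin.pigeonhole (ℕ.≤-<-trans n≤c c<l)
           (λ j → Any.index (P⊆xs (proj₁ (proj₂ (x∈desc (punchIn i j))))))
    = subst P (sym x≡y) y∈P
    where
    cover : ∀ j → ∃[ y ] y ∈ P × lookup x (punchIn i j) ≡ lookup y (punchIn i j)
    cover j = x∈desc (punchIn i j)

    position : ∀ j → proj₁ (cover j) ≡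
      List.lookup xs (Any.index (P⊆xs (proj₁ (proj₂ (cover j)))))
    position j = lookup-index (P⊆xs (proj₁ (proj₂ (cover j))))

    y = proj₁ (cover j)

    y∈P : y ∈ P
    y∈P = proj₁ (proj₂ (cover j))

    y′≡y : proj₁ (cover k) ≡ y
    y′≡y = trans (position k) (trans (cong (List.lookup xs) (sym same)) (sym (position j)))

    x≡y : x ≡ y
    x≡y = rigidᵢ (P⊆C y∈P) (Fin.punchInᵢ≢i i j) (Fin.punchInᵢ≢i i k)
      (Fin.<⇒≢ j<k ∘ Fin.punchIn-injective i j k)
      (proj₂ (proj₂ (cover j)))
      (subst (λ y → lookup x (punchIn i k) ≡ lookup y (punchIn i k)) y′≡y (proj₂ (proj₂ (cover k))))

-- Lengths and congruences.

length-cartesianProduct : ∀ {A B : Set} (xs : List A) (ys : List B) →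
  length (cartesianProduct xs ys) ≡ length xs * length ys
length-cartesianProduct []       ys = refl
length-cartesianProduct (x ∷ xs) ys = trans (List.length-++ (map (x ,_) ys))
  (cong₂ _+_ (List.length-map (x ,_) ys) (length-cartesianProduct xs ys))

length-allFin : ∀ n → length (allFin n) ≡ n
length-allFin n = List.length-tabulate id

mod-≡⇒∣- : ∀ a b n .{{_ : NonZero n}} → a mod n ≡ b mod n → + n ℤ.∣ + a ℤ.- + b
mod-≡⇒∣- a b n eq = ℤ.divides (+ (a / n) ℤ.- + (b / n)) (begin
  + a ℤ.- + b
    ≡⟨ cong₂ ℤ._-_ (expand a)
         (trans (expand b) (cong (λ r → + r ℤ.+ + (b / n) ℤ.* + n) (sym %-≡))) ⟩
  (+ (a % n) ℤ.+ + (a / n) ℤ.* + n) ℤ.- (+ (a % n) ℤ.+ + (b / n) ℤ.* + n)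
    ≡⟨ cancel (+ (a % n)) (+ (a / n)) (+ (b / n)) (+ n) ⟩
  (+ (a / n) ℤ.- + (b / n)) ℤ.* + n ∎)
  where
  open ≡-Reasoning

  %-≡ : a % n ≡ b % n
  %-≡ = Fin.fromℕ<-injective _ _ (m%n<n a n) (m%n<n b n) eq

  expand : ∀ a → + a ≡ + (a % n) ℤ.+ + (a / n) ℤ.* + n
  expand a = trans (cong +_ (m≡m%n+[m/n]*n a n))
    (trans (ℤ.pos-+ (a % n) _) (cong (λ z → + (a % n) ℤ.+ z) (ℤ.pos-* (a / n) n)))

  cancel : ∀ r s t n → (r ℤ.+ s ℤ.* n) ℤ.- (r ℤ.+ t ℤ.* n) ≡ (s ℤ.- t) ℤ.* n
  cancel = ℤRing.solve-∀

-- The small design and the lines.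

Block : Set
Block = Fin 5 × Fin 3

_⊖_ : Fin 5 → Fin 5 → Fin 5
i ⊖ h = (toℕ i + (5 ∸ toℕ h)) mod 5

-- At offset r ≠ 0 from the hole, a block holds its base point u moved by shift r,
-- and the coordinate carries the line α r x + β r y.  Offset 0 is the hole itself:
-- there shift is junk, while α = β = 0 makes letter-line hold trivially.
shift : Fin 5 → ℕ
shift = lookup (0 Vec.∷ 0 Vec.∷ 1 Vec.∷ 1 Vec.∷ 0 Vec.∷ Vec.[])

α β : Fin 5 → ℕ
α = lookup (0 Vec.∷ 1 Vec.∷ 0 Vec.∷ 1 Vec.∷ 1 Vec.∷ Vec.[])
β = lookup (0 Vec.∷ 0 Vec.∷ 1 Vec.∷ 1 Vec.∷ 2 Vec.∷ Vec.[])

-- The base block {0,1,3,7} misses the class 4 mod 5. At offsets 1, 2, 3, 4 from that class it has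
-- 0, 1, 7, 3, whose residues mod 3 are the shifts 0, 1, 1, 0.
point : Fin 5 → Fin 3 → Fin 3
point r u = (toℕ u + shift r) mod 3

-- What a letter retains of the small design. Two holes agree here, as two zero letters do.
symbol : Fin 5 → Fin 3 → Maybe (Fin 3)
symbol 0F        u = nothing
symbol r@(suc _) u = just (point r u)

det : Fin 5 → Fin 5 → ℤ
det r s = + α r ℤ.* + β s ℤ.- + α s ℤ.* + β r

abstract

  ⊖≢0 : ∀ i h → i ≢ h → i ⊖ h ≢ 0F
  ⊖≢0 = from-yes (Fin.all? λ i → Fin.all? λ h → ¬? (i Fin.≟ h) →-dec ¬? (i ⊖ h Fin.≟ 0F))

  -- The determinants at distinct nonzero offsets are ±1 or ±2, hence units modulo an odd number.
  det∣2 : ∀ h j k → j ≢ h → k ≢ h → j ≢ k → det (j ⊖ h) (k ⊖ h) ℤ.∣ + 2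
  det∣2 = from-yes (Fin.all? λ h → Fin.all? λ j → Fin.all? λ k →
    ¬? (j Fin.≟ h) →-dec ¬? (k Fin.≟ h) →-dec ¬? (j Fin.≟ k) →-dec
    det (j ⊖ h) (k ⊖ h) ℤ.∣? + 2)

  -- Every residue mod 15 not divisible by 5 is a difference of {0,1,3,7} exactly once, so two
  -- points in different classes mod 5 lie in a single translate.
  blocks-meet-once : ∀ h u h′ u′ j k → j ≢ h → k ≢ h → j ≢ k →
    symbol (j ⊖ h) u ≡ symbol (j ⊖ h′) u′ → symbol (k ⊖ h) u ≡ symbol (k ⊖ h′) u′ →
    (h , u) ≡ (h′ , u′)
  blocks-meet-once = from-yes
    (Fin.all? λ h → Fin.all? λ u → Fin.all? λ h′ → Fin.all? λ u′ → Fin.all? λ j → Fin.all? λ k →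
    ¬? (j Fin.≟ h) →-dec ¬? (k Fin.≟ h) →-dec ¬? (j Fin.≟ k) →-dec
    Maybe.≡-dec Fin._≟_ (symbol (j ⊖ h) u) (symbol (j ⊖ h′) u′) →-dec
    Maybe.≡-dec Fin._≟_ (symbol (k ⊖ h) u) (symbol (k ⊖ h′) u′) →-dec
    Product.≡-dec Fin._≟_ Fin._≟_ (h , u) (h′ , u′))

-- The inflated code.

module Code (m : ℕ) .{{_ : NonZero m}} (coprime : Coprime m 2) where

  Letter : Set
  Letter = Fin (suc (3 * m))

  Index : Set
  Index = Block × (Fin m × Fin m)

  line : Fin 5 → Fin m × Fin m → Fin m
  line r (x , y) = (α r * toℕ x + β r * toℕ y) mod m

  letter : Fin 5 → Fin 3 → Fin m × Fin m → Letter
  letter 0F        u p = 0F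
  letter r@(suc _) u p = suc (combine (point r u) (line r p))

  entry : Index → Fin 5 → Letter
  entry ((h , u) , p) i = letter (i ⊖ h) u p

  word : Index → Vec Letter 5
  word = tabulate ∘ entry

  entry≢0 : ∀ {h u p i} → i ≢ h → entry ((h , u) , p) i ≢ 0F
  entry≢0 {h} {i = i} i≢h with i ⊖ h in eq
  ... | 0F    = contradiction eq (⊖≢0 i h i≢h)
  ... | suc _ = λ ()

  letter-symbol : ∀ {r r′ u u′ p p′} → letter r u p ≡ letter r′ u′ p′ → symbol r u ≡ symbol r′ u′
  letter-symbol {0F}    {0F}    eq = refl
  letter-symbol {suc _} {suc _} eq =
    cong just (Fin.combine-injectiveˡ _ _ _ _ (Fin.suc-injective eq))

  Δ : Fin m → Fin m → ℤ
  Δ x x′ = + toℕ x ℤ.- + toℕ x′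

  letter-line : ∀ r {u x y x′ y′} → letter r u (x , y) ≡ letter r u (x′ , y′) →
    + m ℤ.∣ + α r ℤ.* Δ x x′ ℤ.+ + β r ℤ.* Δ y y′
  letter-line 0F        eq = ℤ.divides (+ 0) refl
  letter-line r@(suc _) {u} {x} {y} {x′} {y′} eq = subst (+ m ℤ.∣_)
    (trans (cong₂ ℤ._-_ (push (toℕ x) (toℕ y)) (push (toℕ x′) (toℕ y′)))
           (collect (+ α r) (+ β r) (+ toℕ x) (+ toℕ y) (+ toℕ x′) (+ toℕ y′)))
    (mod-≡⇒∣- (α r * toℕ x + β r * toℕ y) (α r * toℕ x′ + β r * toℕ y′) m
      (Fin.combine-injectiveʳ (point r u) (line r (x , y)) (point r u) (line r (x′ , y′))
        (Fin.suc-injective eq)))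
    where
    push : ∀ x y → + (α r * x + β r * y) ≡ + α r ℤ.* + x ℤ.+ + β r ℤ.* + y
    push x y = trans (ℤ.pos-+ (α r * x) (β r * y))
      (cong₂ ℤ._+_ (ℤ.pos-* (α r) x) (ℤ.pos-* (β r) y))

    collect : ∀ a b x y x′ y′ →
      (a ℤ.* x ℤ.+ b ℤ.* y) ℤ.- (a ℤ.* x′ ℤ.+ b ℤ.* y′) ≡ a ℤ.* (x ℤ.- x′) ℤ.+ b ℤ.* (y ℤ.- y′)
    collect = ℤRing.solve-∀

  -- Coprimality removes the factor 2, and a multiple of `m` of absolute value below `m` is 0.
  ∣2Δ⇒≡ : ∀ {x x′} → + m ℤ.∣ + 2 ℤ.* Δ x x′ → x ≡ x′
  ∣2Δ⇒≡ {x} {x′} m∣2Δ = Fin.toℕ-injective (ℤ.+-injective (ℤ.i-j≡0⇒i≡j _ _ (ℤ.∣i∣≡0⇒i≡0 ∣Δ∣≡0)))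
    where
    m∣∣Δ∣ : m ∣ ℤ.∣ Δ x x′ ∣
    m∣∣Δ∣ = coprime-divisor coprime
      (subst (m ∣_) (ℤ.abs-* (+ 2) (Δ x x′)) (ℤ.∣⇒∣ᵤ m∣2Δ))

    ∣Δ∣<m : ℤ.∣ Δ x x′ ∣ < m
    ∣Δ∣<m = ℕ.≤-<-trans
      (subst (λ z → ℤ.∣ z ∣ ≤ toℕ x ⊔ toℕ x′) (sym (ℤ.m-n≡m⊖n (toℕ x) (toℕ x′)))
        (ℤ.∣m⊝n∣≤m⊔n (toℕ x) (toℕ x′)))
      (ℕ.⊔-pres-<m (Fin.toℕ<n x) (Fin.toℕ<n x′))

    ∣Δ∣≡0 : ℤ.∣ Δ x x′ ∣ ≡ 0
    ∣Δ∣≡0 with ℤ.∣ Δ x x′ ∣ ℕ.≟ 0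
    ... | yes ≡0 = ≡0
    ... | no  ≢0 = contradiction m∣∣Δ∣ (ℕ.>⇒∤ {{≢-nonZero ≢0}} ∣Δ∣<m)

  -- Cramer's rule without division: eliminating one difference leaves `det r s` times the other, a
  -- multiple of `m`, and `det r s` may be enlarged to 2.
  lines-meet-once : ∀ {r s u x y x′ y′} → det r s ℤ.∣ + 2 →
    letter r u (x , y) ≡ letter r u (x′ , y′) → letter s u (x , y) ≡ letter s u (x′ , y′) →
    (x , y) ≡ (x′ , y′)
  lines-meet-once {r} {s} {u} {x} {y} {x′} {y′} det∣2 eqʳ eqˢ = cong₂ _,_
    (∣2Δ⇒≡ (double (subst (+ m ℤ.∣_)
      (cramerˣ (+ α r) (+ β r) (+ α s) (+ β s) (Δ x x′) (Δ y y′))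
      (ℤ.∣m∣n⇒∣m-n (ℤ.∣n⇒∣m*n (+ β s) m∣r) (ℤ.∣n⇒∣m*n (+ β r) m∣s)))))
    (∣2Δ⇒≡ (double (subst (+ m ℤ.∣_)
      (cramerʸ (+ α r) (+ β r) (+ α s) (+ β s) (Δ x x′) (Δ y y′))
      (ℤ.∣m∣n⇒∣m-n (ℤ.∣n⇒∣m*n (+ α r) m∣s) (ℤ.∣n⇒∣m*n (+ α s) m∣r)))))
    where
    m∣r = letter-line r {u} {x} {y} {x′} {y′} eqʳ
    m∣s = letter-line s {u} {x} {y} {x′} {y′} eqˢ

    double : ∀ {z} → + m ℤ.∣ det r s ℤ.* z → + m ℤ.∣ + 2 ℤ.* z
    double {z} m∣ = ℤ.∣-trans m∣ (ℤ.*-monoˡ-∣ z det∣2)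

    cramerˣ : ∀ a b c d x y →
      d ℤ.* (a ℤ.* x ℤ.+ b ℤ.* y) ℤ.- b ℤ.* (c ℤ.* x ℤ.+ d ℤ.* y) ≡ (a ℤ.* d ℤ.- c ℤ.* b) ℤ.* x
    cramerˣ = ℤRing.solve-∀

    cramerʸ : ∀ a b c d x y →
      a ℤ.* (c ℤ.* x ℤ.+ d ℤ.* y) ℤ.- c ℤ.* (a ℤ.* x ℤ.+ b ℤ.* y) ≡ (a ℤ.* d ℤ.- c ℤ.* b) ℤ.* y
    cramerʸ = ℤRing.solve-∀

  -- The Z₃ parts of the two letters fix the block; with the block shared, the Z_m parts fix `p`.
  entries-determine : ∀ {h u p w′ j k} → j ≢ h → k ≢ h → j ≢ k →
    entry ((h , u) , p) j ≡ entry w′ j → entry ((h , u) , p) k ≡ entry w′ k → ((h , u) , p) ≡ w′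
  entries-determine {h} {u} {p} {(h′ , u′) , p′} {j} {k} j≢h k≢h j≢k eqʲ eqᵏ
    with refl ← blocks-meet-once h u h′ u′ j k j≢h k≢h j≢k
                  (letter-symbol {j ⊖ h} eqʲ) (letter-symbol {k ⊖ h} eqᵏ)
    = cong ((h , u) ,_) (lines-meet-once {j ⊖ h} {k ⊖ h} (det∣2 h j k j≢h k≢h j≢k) eqʲ eqᵏ)

  word-entry : ∀ {w w′} → word w ≡ word w′ → ∀ i → entry w i ≡ entry w′ i
  word-entry {w} {w′} eq i = trans (sym (lookup∘tabulate (entry w) i))
    (trans (cong (λ v → lookup v i) eq) (lookup∘tabulate (entry w′) i))

  word-injective : ∀ {w w′} → word w ≡ word w′ → w ≡ w′
  word-injective {(h , u) , p} {w′} eq = entries-determine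
    (Fin.punchInᵢ≢i h 0F) (Fin.punchInᵢ≢i h 1F) ((λ ()) ∘ Fin.punchIn-injective h 0F 1F)
    (word-entry {(h , u) , p} {w′} eq (punchIn h 0F))
    (word-entry {(h , u) , p} {w′} eq (punchIn h 1F))

  zeroWord : Vec Letter 5
  zeroWord = replicate 5 0F

  zero≢entry : ∀ {h u p i} → i ≢ h → lookup zeroWord i ≢ lookup (word ((h , u) , p)) i
  zero≢entry {h} {u} {p} {i} i≢h eq = entry≢0 i≢h
    (trans (sym (lookup∘tabulate (entry ((h , u) , p)) i))
      (trans (sym eq) (lookup-replicate i 0F)))

  indices : List Index
  indices = cartesianProduct (cartesianProduct (allFin 5) (allFin 3))
                             (cartesianProduct (allFin m) (allFin m))

  codewords : List (Vec Letter 5)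
  codewords = zeroWord ∷ map word indices

  rigid : ∀ {x} → x ∈ˡ codewords → ∃[ i ] RigidOff i (_∈ˡ codewords) x
  -- The choice of `0F` is arbitrary: a word with a single zero cannot agree with the zero word
  -- twice.
  rigid (here refl) = 0F , rigid₀
    where
    rigid₀ : RigidOff 0F (_∈ˡ codewords) zeroWord
    rigid₀ (here refl) _ _ _ _ _ = refl
    rigid₀ (there y∈) {j} {k} _ _ j≢k eqʲ eqᵏ
      with ((h , u) , p) , _ , refl ← ∈-map⁻ word y∈ with j Fin.≟ h
    ... | no  j≢h  = contradiction eqʲ (zero≢entry j≢h)
    ... | yes refl = contradiction eqᵏ (zero≢entry (j≢k ∘ sym))
  rigid (there x∈) with ((h , u) , p) , _ , refl ← ∈-map⁻ word x∈ = h , rigidʷ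
    where
    w = (h , u) , p

    rigidʷ : RigidOff h (_∈ˡ codewords) (word w)
    rigidʷ (here refl) j≢h _ _ eqʲ _ = contradiction (sym eqʲ) (zero≢entry j≢h)
    rigidʷ (there y∈) {j} {k} j≢h k≢h j≢k eqʲ eqᵏ with w′ , _ , refl ← ∈-map⁻ word y∈ =
      cong word (entries-determine {w′ = w′} j≢h k≢h j≢k (entry-≡ j eqʲ) (entry-≡ k eqᵏ))
      where
      entry-≡ : ∀ i → lookup (word w) i ≡ lookup (word w′) i → entry w i ≡ entry w′ i
      entry-≡ i eq = trans (sym (lookup∘tabulate (entry w) i))
        (trans eq (lookup∘tabulate (entry w′) i))

  code : FrameproofCode (suc (3 * m)) 3 5
  code = record
    { Alphabet   = Letter
    ; q-ary      = ↔-id Letter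
    ; Codeword   = _∈ˡ codewords
    -- Length 5 leaves four coordinates, just one more than `c = 3`.
    ; frameproof = rigid⇒frameproof (s≤s (s≤s z≤n)) ℕ.≤-refl rigid
    }

  code-size : HasSize (FrameproofCode.Codeword code) (15 * (m * m) + 1)
  code-size = codewords ,
    (All.tabulate zero∉ ∷ Unique.map⁺ word-injective unique-indices) , size , id , id
    where
    zero∉ : ∀ {y} → y ∈ˡ map word indices → zeroWord ≢ y
    zero∉ y∈ eq with ((h , u) , p) , _ , refl ← ∈-map⁻ word y∈ =
      zero≢entry (Fin.punchInᵢ≢i h 0F) (cong (λ v → lookup v (punchIn h 0F)) eq)

    unique-indices = Unique.cartesianProduct⁺
      (Unique.cartesianProduct⁺ (Unique.allFin⁺ 5) (Unique.allFin⁺ 3))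
      (Unique.cartesianProduct⁺ (Unique.allFin⁺ m) (Unique.allFin⁺ m))

    open ≡-Reasoning

    size : length codewords ≡ 15 * (m * m) + 1
    size = begin
      suc (length (map word indices))
        ≡⟨ cong suc (List.length-map word indices) ⟩
      suc (length indices)
        ≡⟨ cong suc (length-cartesianProduct (cartesianProduct (allFin 5) (allFin 3))
             (cartesianProduct (allFin m) (allFin m))) ⟩
      suc (15 * length (cartesianProduct (allFin m) (allFin m)))
        ≡⟨ cong (λ n → suc (15 * n)) (length-cartesianProduct (allFin m) (allFin m)) ⟩
      suc (15 * (length (allFin m) * length (allFin m)))
        ≡⟨ cong (λ n → suc (15 * (n * n))) (length-allFin m) ⟩
      suc (15 * (m * m))
        ≡⟨ ℕ.+-comm 1 _ ⟩
      15 * (m * m) + 1 ∎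

-- Arithmetic of `q` and the conclusion.

odd-coprime-2 : ∀ k → Coprime (suc (k * 2)) 2
odd-coprime-2 k {d} (d∣odd , d∣2) =
  ℕ.∣1⇒≡1 (ℕ.∣m+n∣m⇒∣n (subst (d ∣_) (ℕ.+-comm 1 (k * 2)) d∣odd) (ℕ.∣n⇒∣m*n k d∣2))

≡4mod6⇒odd : ∀ q → q % 6 ≡ 4 → ∃[ k ] q ≡ suc (3 * suc (k * 2))
≡4mod6⇒odd q q%6≡4 = q / 6 ,
  trans (m≡m%n+[m/n]*n q 6) (trans (cong (_+ q / 6 * 6) q%6≡4) (regroup (q / 6)))
  where
  regroup : ∀ k → 4 + k * 6 ≡ suc (3 * suc (k * 2))
  regroup = ℕRing.solve-∀

cardinality : ∀ m → 15 * (m * m) ≡ (5 * (3 * m) ^ 2) / 3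
cardinality m = sym (trans (cong (_/ 3) (regroup m)) (m*n/n≡m (15 * (m * m)) 3))
  where
  regroup : ∀ m → 5 * (3 * m * (3 * m * 1)) ≡ 15 * (m * m) * 3
  regroup = ℕRing.solve-∀

theorem3 : ∀ (q : ℕ) → q % 6 ≡ 4 →
    Σ[ C ∈ FrameproofCode q 3 5 ]
    HasSize (FrameproofCode.Codeword C) ((5 * (q ∸ 1) ^ 2) / 3 + 1)
-- From q = 6k + 4 comes q - 1 = 3(2k + 1), so m = 2k + 1 is odd and `q ∸ 1` reduces to `3 * m`.
theorem3 q q%6≡4 with k , refl ← ≡4mod6⇒odd q q%6≡4 =
  code , subst (HasSize (FrameproofCode.Codeword code)) (cong (_+ 1) (cardinality m)) code-size
  where
  m = suc (k * 2)
  open Code m (odd-coprime-2 k)
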